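{- The class $\mathsf{BW}_1$ crosses both the class of chordal graphs and the class of interval graphs. That is, for $\mathcal C$ being the class of chordal graphs and also for $\mathcal C$ being the class of interval graphs: $\mathsf{BW}_1\cap\mathcal C\neq\emptyset$, $\mathsf{BW}_1\not\subseteq\mathcal C$ and $\mathcal C\not\subseteq\mathsf{BW}_1$.
   Context: Graphs are finite and simple. A graph is chordal if it has no induced cycle on four or more vertices; it is interval if it is the intersection graph of intervals on a line. Two sets (classes) are crossing if their intersection is non-empty and neither is a subset of the other. Two adjacent vertices $u,v$ of $G$ are twins if $N_G(u)\setminus\{v\} = N_G(v)\setminus\{u\}$. A bubble of $G$ is a maximal set of pairwise twin vertices (possibly a single vertex); the bubbles partition $V(G)$. A bubble partition of $G$ is a partition $\mathcal V=\{V_1,\dots,V_k\}$ of $V(G)$ such that every $V_i$ is a union of bubbles of $G$ and the graph obtained from $G$ by contracting every $V_i$ to a single vertex (vertices $i\neq j$ being adjacent iff $G$ has an edge between $V_i$ and $V_j$) is a tree, possibly with a single vertex. The independence number of $\mathcal V$ is $\alpha(\mathcal V)=\max_i\alpha(G[V_i])$, where $\alpha(H)$ is the maximum size of an independent set of $H$. $\mathsf{BW}_1$ is the class of graphs that have a bubble partition $\mathcal V$ with $\alpha(\mathcal V)\le 1$ (i.e. every $V_i$ is a clique). -}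

module Defs where

open import Data.Fin using (Fin; toℕ)
open import Data.Fin.Properties using (_≟_; all?; any?)
open import Data.Fin.Subset using (Subset; inside; outside; _∈_; _⊆_; _-_; ⋃; ∣_∣; Nonempty)
open import Data.Fin.Subset.Properties using (_∈?_)
open import Data.List using (List; []; _∷_; _++_; map; filter; lookup; length; allFin)
open import Data.List.Extrema.Nat using (max)
open import Data.List.Relation.Unary.All using (All)
open import Data.Nat using (ℕ; zero; suc; NonZero; _≤_)
import Data.Nat.Properties as ℕ
open import Data.Product using (Σ; ∃; ∃!; _×_; _,_; swap)
open import Data.Rational using (ℚ) renaming (_≤_ to _≤ℚ_)
open import Data.Sum using (_⊎_) renaming (swap to ⊎-swap)
open import Data.Vec using ([]; _∷_; tabulate)
open import Function using (_⇔_; _∘_)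
open import Function.Definitions using (Injective)
open import Level using (_⊔_; 0ℓ)
open import Relation.Binary using (Rel; Decidable; Symmetric; Irreflexive)
open import Relation.Binary.Construct.Closure.ReflexiveTransitive using (Star)
open import Relation.Binary.PropositionalEquality using (_≡_; _≢_; refl; sym)
open import Relation.Nullary using (¬_; Dec; does)
open import Relation.Nullary.Decidable using (¬?; _×-dec_; _⊎-dec_; _→-dec_)
open import Relation.Unary using (Pred; _≬_; _⊈_)

private
  variable
    m n k : ℕ

record Graph (n : ℕ) : Set₁ where
  infix 4 _~_ _~?_
  field
    _~_      : Rel (Fin n) 0ℓ
    _~?_     : Decidable _~_
    ~-sym    : Symmetric _~_
    ~-irrefl : Irreflexive _≡_ _~_

  N : Fin n → Subset n
  N u = tabulate (λ v → does (u ~? v))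

-- The graph without vertices is excluded. A tree has at least one vertex, so that
-- graph would be vacuously outside every BW r while being chordal and interval.
FiniteGraph : Set₁
FiniteGraph = ∃ λ n → Graph (suc n)

elements : Subset n → List (Fin n)
elements {n} U = filter (_∈? U) (allFin n)

-- The induced subgraph G[U], with the vertices of U renumbered in order.
induced : Graph n → (U : Subset n) → Graph (length (elements U))
induced G U = record
  { _~_      = λ i j → lookup (elements U) i ~ lookup (elements U) j
  ; _~?_     = λ i j → lookup (elements U) i ~? lookup (elements U) j
  ; ~-sym    = ~-sym
  ; ~-irrefl = λ { refl → ~-irrefl refl }
  }
  where open Graph G

record _embedsIn_ (H : Graph m) (G : Graph n) : Set where
  private
    module H = Graph H
    module G = Graph G
  field
    vertex    : Fin m → Fin n
    injective : Injective _≡_ _≡_ vertex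
    edges     : ∀ {i j} → i H.~ j → vertex i G.~ vertex j

record _inducedIn_ (H : Graph m) (G : Graph n) : Set where
  private
    module H = Graph H
    module G = Graph G
  field
    vertex    : Fin m → Fin n
    injective : Injective _≡_ _≡_ vertex
    edges     : ∀ {i j} → i H.~ j ⇔ vertex i G.~ vertex j

-- j comes right after i in the cyclic order 0, 1, …, m - 1, 0.
Next : ∀ m → Rel (Fin m) 0ℓ
Next m i j = suc (toℕ i) ≡ toℕ j ⊎ (suc (toℕ i) ≡ m × toℕ j ≡ 0)

next? : ∀ m → Decidable (Next m)
next? m i j = (suc (toℕ i) ℕ.≟ toℕ j) ⊎-dec ((suc (toℕ i) ℕ.≟ m) ×-dec (toℕ j ℕ.≟ 0))

-- A cycle in the usual sense only for m ≥ 3.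
cycle : ∀ m → Graph m
cycle m = record
  { _~_      = λ i j → i ≢ j × (Next m i j ⊎ Next m j i)
  ; _~?_     = λ i j → ¬? (i ≟ j) ×-dec (next? m i j ⊎-dec next? m j i)
  ; ~-sym    = λ (i≢j , p) → i≢j ∘ sym , ⊎-swap p
  ; ~-irrefl = λ i≡j (i≢j , _) → i≢j i≡j
  }

Connected : Graph n → Set
Connected G = ∀ u v → Star (Graph._~_ G) u v

Acyclic : Graph n → Set
Acyclic G = ∀ m → 3 ≤ m → ¬ (cycle m embedsIn G)

Tree : Graph n → Set
Tree {n} G = NonZero n × Connected G × Acyclic G

Chordal : Pred FiniteGraph 0ℓ
Chordal (_ , G) = ∀ m → 4 ≤ m → ¬ (cycle m inducedIn G)

-- Closed intervals of the rational line. As only finitely many endpoints are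
-- involved, these give the same graphs as intervals of the real line.
record ClosedInterval : Set where
  field
    left right : ℚ
    left≤right : left ≤ℚ right

_∈ᴵ_ : ℚ → ClosedInterval → Set
x ∈ᴵ I = left ≤ℚ x × x ≤ℚ right
  where open ClosedInterval I

Interval : Pred FiniteGraph 0ℓ
Interval (n , G) = Σ (Fin (suc n) → ClosedInterval) λ I →
  ∀ u v → u ≢ v → u ~ v ⇔ (∃ λ x → x ∈ᴵ I u × x ∈ᴵ I v)
  where open Graph G

subsets : ∀ n → List (Subset n)
subsets zero    = [] ∷ []
subsets (suc n) = map (outside ∷_) (subsets n) ++ map (inside ∷_) (subsets n)

module _ (G : Graph n) where
  open Graph G

  Independent : Subset n → Set
  Independent S = ∀ u v → u ∈ S → v ∈ S → ¬ (u ~ v)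

  independent? : ∀ S → Dec (Independent S)
  independent? S = all? λ u → all? λ v →
    (u ∈? S) →-dec ((v ∈? S) →-dec ¬? (u ~? v))

  α : ℕ
  α = max 0 (map ∣_∣ (filter independent? (subsets n)))

  Twins : Rel (Fin n) 0ℓ
  Twins u v = u ~ v × (N u - v) ≡ (N v - u)

  PairwiseTwins : Subset n → Set
  PairwiseTwins B = ∀ u v → u ∈ B → v ∈ B → u ≢ v → Twins u v

  Bubble : Subset n → Set
  Bubble B = PairwiseTwins B × (∀ C → PairwiseTwins C → B ⊆ C → C ⊆ B)

  UnionOfBubbles : Subset n → Set
  UnionOfBubbles U = ∃ λ bubbles → All Bubble bubbles × U ≡ ⋃ bubbles

  contract : (Fin k → Subset n) → Graph k
  contract V = record
    { _~_      = λ i j → i ≢ j × ∃ λ u → ∃ λ v → (u ∈ V i × v ∈ V j) × u ~ v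
    ; _~?_     = λ i j → ¬? (i ≟ j) ×-dec
                   any? λ u → any? λ v → ((u ∈? V i) ×-dec (v ∈? V j)) ×-dec (u ~? v)
    ; ~-sym    = λ (i≢j , u , v , p , u~v) → i≢j ∘ sym , v , u , swap p , ~-sym u~v
    ; ~-irrefl = λ i≡j (i≢j , _) → i≢j i≡j
    }

  record BubblePartition : Set where
    field
      size       : ℕ
      class      : Fin size → Subset n
      nonempty   : ∀ i → Nonempty (class i)
      partition  : ∀ v → ∃! _≡_ λ i → v ∈ class i
      bubbles    : ∀ i → UnionOfBubbles (class i)
      tree       : Tree (contract class)

α-partition : (G : Graph n) → BubblePartition G → ℕ
α-partition G 𝒱 = max 0 (map (λ i → α (induced G (class i))) (allFin size))
  where open BubblePartition 𝒱

BW : ℕ → Pred FiniteGraph 0ℓ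
BW r (_ , G) = ∃ λ (𝒱 : BubblePartition G) → α-partition G 𝒱 ≤ r

Crossing : ∀ {a ℓ₁ ℓ₂} {A : Set a} → Pred A ℓ₁ → Pred A ℓ₂ → Set (a ⊔ ℓ₁ ⊔ ℓ₂)
Crossing P Q = P ≬ Q × P ⊈ Q × Q ⊈ P

{-# OPTIONS --safe #-}

-- An interval graph is chordal: on an induced cycle, the two neighbours of the vertex
-- whose interval ends first both contain that end, so they are adjacent, which is
-- impossible on a cycle of length at least 4.  Hence it suffices to give
-- • a graph in BW₁ that is interval: the single vertex;
-- • a graph in BW₁ that is not chordal: C₄, whose bubbles are its single vertices, with
--   the classes {0,1} and {2,3};
-- • an interval graph outside BW₁: 2P₃ with a universal vertex u added.  If the classes
--   are cliques whose contraction has no triangle, then each P₃ has a vertex in the class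
--   of u, for otherwise the triangles u a b and u b c put both ends a, c of the P₃ in one
--   class; these two vertices lie in a clique but in different components of 2P₃.
module Submission where

open import Defs
open import Data.Bool.Properties using () renaming (_≟_ to _≟ᵇ_)
open import Data.Fin using (Fin; zero; suc; toℕ; fromℕ; fromℕ<; inject₁; _↑ˡ_; _↑ʳ_; #_)
open import Data.Fin.Properties
  using (_≟_; all?; any?; toℕ<n; toℕ-fromℕ; toℕ-fromℕ<; toℕ-inject₁; <⇒notInjective)
open import Data.Fin.Subset
  using (Subset; inside; outside; _∈_; _∪_; _-_; ⁅_⁆; ∣_∣)
open import Data.Fin.Subset.Properties
  using (x∈⁅x⁆; x∈⁅y⁆⇒x≡y; ∣⁅x⁆∣≡1; p⊆p∪q; q⊆p∪q; x∈p∪q⁻; p⊂q⇒∣p∣<∣q∣; _∈?_)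
open import Data.List using ([]; _∷_; map; lookup; allFin)
open import Data.List.Extrema.Nat using (xs≤max)
open import Data.List.Membership.Propositional using () renaming (_∈_ to _∈ˡ_)
open import Data.List.Membership.Propositional.Properties
  using (∈-map⁺; ∈-++⁺ˡ; ∈-++⁺ʳ; ∈-filter⁺; ∈-allFin)
open import Data.List.Relation.Unary.All as All using ([]; _∷_)
open import Data.List.Relation.Unary.Any as Any using ()
open import Data.List.Relation.Unary.Any.Properties using (lookup-index)
open import Data.Nat using (ℕ; zero; suc; _+_; _≤_; _<_; z≤n; s≤s; nonZero)
import Data.Nat.Properties as ℕ
open import Data.Product using (∃; _×_; _,_; proj₁; proj₂)
open import Data.Rational using (ℚ; 0ℚ; 1ℚ; _⊔_; _≤?_) renaming (_≤_ to _≤ℚ_; _+_ to _+ℚ_)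
import Data.Rational.Properties as ℚ
open import Data.Sum using (_⊎_; inj₁; inj₂; [_,_]′)
open import Data.Vec as Vec using ([]; _∷_)
open import Data.Vec.Properties using (≡-dec)
open import Function using (_∘_; mk⇔)
open import Function.Bundles using (module Equivalence)
open import Relation.Binary using (Decidable; DecTotalOrder)
open import Relation.Binary.Construct.Closure.ReflexiveTransitive using (ε; _◅_)
open import Relation.Binary.PropositionalEquality
  using (_≡_; _≢_; refl; sym; trans; cong; subst; subst₂)
open import Relation.Nullary using (¬_; yes; no; contradiction)
open import Relation.Nullary.Decidable
  using (True; toWitness; from-yes; ¬?; _×-dec_; _→-dec_; decidable-stable)

open import Data.List.Extrema (DecTotalOrder.totalOrder ℚ.≤-decTotalOrder)
  using (argmin; f[argmin]≤f[xs])

private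
  variable
    m n : ℕ

-- Cycles

-- Next m i j is Step m (toℕ i) (toℕ j); on ℕ the equations can be matched with refl.
Step : ℕ → ℕ → ℕ → Set
Step m i j = suc i ≡ j ⊎ (suc i ≡ m × j ≡ 0)

-- The clauses distinguish which of the two steps wraps around to 0. Length at least 4 makes every
-- resulting equation absurd; at length 3, `k` would step back to `i`.
two-steps : ∀ {i j k} → Step (4 + m) i j → Step (4 + m) j k →
            i ≢ k × ¬ Step (4 + m) i k × ¬ Step (4 + m) k i
two-steps (inj₁ refl) (inj₁ refl) =
  (λ ()) , (λ { (inj₁ ()) ; (inj₂ (_ , ())) }) , (λ { (inj₁ ()) ; (inj₂ (() , refl)) })
two-steps (inj₁ refl) (inj₂ (refl , refl)) =
  (λ ()) , (λ { (inj₁ ()) ; (inj₂ (() , _)) }) , (λ { (inj₁ ()) ; (inj₂ (() , _)) })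
two-steps (inj₂ (refl , refl)) (inj₁ refl) =
  (λ ()) , (λ { (inj₁ ()) ; (inj₂ (_ , ())) }) , (λ { (inj₁ ()) ; (inj₂ (() , _)) })
two-steps (inj₂ (_ , refl)) (inj₂ (() , _))

Next-irrefl : 2 ≤ m → ∀ {i j : Fin m} → Next m i j → i ≢ j
Next-irrefl _   (inj₁ 1+i≡i)         refl = ℕ.1+n≢n 1+i≡i
Next-irrefl 2≤m (inj₂ (1+i≡m , i≡0)) refl =
  ℕ.<⇒≢ 2≤m (trans (cong suc (sym i≡0)) 1+i≡m)

successor : ∀ (i : Fin m) → ∃ λ j → Next m i j
successor {suc m} i with suc (toℕ i) ℕ.<? suc m
... | yes 1+i<m = fromℕ< 1+i<m , inj₁ (sym (toℕ-fromℕ< 1+i<m))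
... | no  1+i≮m = zero , inj₂ (ℕ.≤-antisym (toℕ<n i) (ℕ.≮⇒≥ 1+i≮m) , refl)

predecessor : ∀ (i : Fin m) → ∃ λ j → Next m j i
predecessor {suc m} zero    = fromℕ m , inj₂ (cong suc (toℕ-fromℕ m) , refl)
predecessor {suc m} (suc i) = inject₁ i , inj₁ (cong suc (toℕ-inject₁ i))

nonadjacent-neighbours : 4 ≤ m → ∀ i → let open Graph (cycle m) in
  ∃ λ j → ∃ λ k → i ~ j × i ~ k × j ≢ k × ¬ (j ~ k)
nonadjacent-neighbours (s≤s (s≤s (s≤s (s≤s _)))) i =
  let j , j→i = predecessor i
      k , i→k = successor i
      j≢k , j↛k , k↛j = two-steps j→i i→k
      2≤m = s≤s (s≤s z≤n)
  in  j , k
    , (Next-irrefl 2≤m j→i ∘ sym , inj₂ j→i)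
    , (Next-irrefl 2≤m i→k , inj₁ i→k)
    , j≢k ∘ cong toℕ
    , [ j↛k , k↛j ]′ ∘ proj₂

-- A triangle is an embedded `cycle 3`. Adjacency of the images of distinct indices also yields
-- injectivity, as `G` has no loops.
acyclic-triangle-free : ∀ {G : Graph n} → Acyclic G → let open Graph G in
  ∀ {a b c} → a ~ b → b ~ c → ¬ (a ~ c)
acyclic-triangle-free {n = n} {G = G} acyclic {a} {b} {c} ab bc ac =
  acyclic 3 ℕ.≤-refl record
    { vertex    = f
    ; injective = λ {i j} fi≡fj →
        decidable-stable (i ≟ j) λ i≢j → ~-irrefl fi≡fj (adjacent i j i≢j)
    ; edges     = λ {i j} → adjacent i j ∘ proj₁
    }
  where
  open Graph G
  f : Fin 3 → Fin n
  f zero             = a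
  f (suc zero)       = b
  f (suc (suc zero)) = c
  adjacent : ∀ i j → i ≢ j → f i ~ f j
  adjacent zero             zero             i≢i = contradiction refl i≢i
  adjacent zero             (suc zero)       _   = ab
  adjacent zero             (suc (suc zero)) _   = ac
  adjacent (suc zero)       zero             _   = ~-sym ab
  adjacent (suc zero)       (suc zero)       i≢i = contradiction refl i≢i
  adjacent (suc zero)       (suc (suc zero)) _   = bc
  adjacent (suc (suc zero)) zero             _   = ~-sym ac
  adjacent (suc (suc zero)) (suc zero)       _   = ~-sym bc
  adjacent (suc (suc zero)) (suc (suc zero)) i≢i = contradiction refl i≢i

-- A cycle would inject at least three vertices into fewer than three.
acyclic-small : n < 3 → (G : Graph n) → Acyclic G
acyclic-small n<3 _ m 3≤m C = <⇒notInjective (ℕ.<-≤-trans n<3 3≤m) (_embedsIn_.injective C)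

-- Interval graphs

open ClosedInterval

-- Comparing endpoints makes intersection decidable, so adjacency in a concrete intersection graph
-- can be evaluated.
Meets : ClosedInterval → ClosedInterval → Set
Meets I J = left I ≤ℚ right J × left J ≤ℚ right I

common-point⇒meets : ∀ {I J x} → x ∈ᴵ I → x ∈ᴵ J → Meets I J
common-point⇒meets (l≤x , x≤r) (l′≤x , x≤r′) = ℚ.≤-trans l≤x x≤r′ , ℚ.≤-trans l′≤x x≤r

meets⇒common-point : ∀ {I J} → Meets I J → ∃ λ x → x ∈ᴵ I × x ∈ᴵ J
meets⇒common-point {I} {J} (l≤r′ , l′≤r) =
    -- The larger left end lies in both intervals.
    left I ⊔ left J
  , (ℚ.p≤p⊔q (left I) (left J) , ℚ.⊔-lub (left≤right I) l′≤r)
  , (ℚ.p≤q⊔p (left I) (left J) , ℚ.⊔-lub l≤r′ (left≤right J))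

intersectionGraph : (Fin n → ClosedInterval) → Graph n
intersectionGraph I = record
  { _~_      = λ u v → u ≢ v × Meets (I u) (I v)
  ; _~?_     = λ u v → ¬? (u ≟ v) ×-dec
                 ((left (I u) ≤? right (I v)) ×-dec (left (I v) ≤? right (I u)))
  ; ~-sym    = λ (u≢v , p , q) → u≢v ∘ sym , q , p
  ; ~-irrefl = λ u≡v (u≢v , _) → u≢v u≡v
  }

intersectionGraph-interval : (I : Fin (suc n) → ClosedInterval) →
  Interval (n , intersectionGraph I)
intersectionGraph-interval I = I , λ u v u≢v → mk⇔
  (λ (_ , meets) → meets⇒common-point {I u} {I v} meets)
  (λ (_ , x∈Iu , x∈Iv) → u≢v , common-point⇒meets {I u} {I v} x∈Iu x∈Iv)

interval⇒chordal : ∀ {G} → Interval G → Chordal G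
interval⇒chordal {_ , G} (I , adj) (suc m) 4≤m C =
  j≁k (Equivalence.from C.edges (Equivalence.from (adj _ _ fj≢fk) (_ , end∈ i~j , end∈ i~k)))
  where
  module C = _inducedIn_ C
  open Graph (cycle (suc m)) using (_~_; ~-irrefl)
  end : Fin (suc m) → ℚ
  end = right ∘ I ∘ C.vertex
  i : Fin (suc m)
  -- The default `zero` exists because the length was matched as `suc m`.
  i = argmin end zero (allFin (suc m))
  end-minimal : ∀ j → end i ≤ℚ end j
  end-minimal j = All.lookup (f[argmin]≤f[xs] {f = end} zero (allFin (suc m))) (∈-allFin j)
  end∈ : ∀ {j} → i ~ j → end i ∈ᴵ I (C.vertex j)
  -- A common point of the two intervals bounds `left` of the second by `end i`; minimality of
  -- `end i` bounds its `right`.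
  end∈ {j} i~j =
    let i≢j = λ i≡j → ~-irrefl i≡j i~j
        _ , (_ , x≤end) , (left≤x , _) =
          Equivalence.to (adj _ _ (i≢j ∘ C.injective)) (Equivalence.to C.edges i~j)
    in ℚ.≤-trans left≤x x≤end , end-minimal j
  neighbours = nonadjacent-neighbours 4≤m i
  j = proj₁ neighbours
  k = proj₁ (proj₂ neighbours)
  i~j : i ~ j
  i~j = proj₁ (proj₂ (proj₂ neighbours))
  i~k : i ~ k
  i~k = proj₁ (proj₂ (proj₂ (proj₂ neighbours)))
  fj≢fk : C.vertex j ≢ C.vertex k
  fj≢fk = proj₁ (proj₂ (proj₂ (proj₂ (proj₂ neighbours)))) ∘ C.injective
  j≁k : ¬ (j ~ k)
  j≁k = proj₂ (proj₂ (proj₂ (proj₂ (proj₂ neighbours))))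

-- Independence number

∈-subsets : (S : Subset n) → S ∈ˡ subsets n
∈-subsets []                        = Any.here refl
∈-subsets             (outside ∷ S) = ∈-++⁺ˡ (∈-map⁺ (outside ∷_) (∈-subsets S))
∈-subsets {n = suc n} (inside  ∷ S) =
  ∈-++⁺ʳ (map (outside ∷_) (subsets n)) (∈-map⁺ (inside ∷_) (∈-subsets S))

independent⇒≤α : (G : Graph n) → ∀ {S} → Independent G S → ∣ S ∣ ≤ α G
independent⇒≤α G {S} ind = All.lookup (xs≤max 0 _)
  (∈-map⁺ ∣_∣ (∈-filter⁺ (independent? G) (∈-subsets S) ind))

nonadjacent⇒2≤α : (G : Graph n) → let open Graph G in ∀ {u v} → u ≢ v → ¬ (u ~ v) → 2 ≤ α G
nonadjacent⇒2≤α G {u} {v} u≢v u≁v = ℕ.≤-trans 2≤∣S∣ (independent⇒≤α G independent)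
  where
  open Graph G
  S = ⁅ u ⁆ ∪ ⁅ v ⁆
  2≤∣S∣ : 2 ≤ ∣ S ∣
  -- `⁅ u ⁆` has size 1 and is a proper subset of `S`, which also contains `v`.
  2≤∣S∣ = subst (_< ∣ S ∣) (∣⁅x⁆∣≡1 u) (p⊂q⇒∣p∣<∣q∣
    (p⊆p∪q ⁅ v ⁆ , v , q⊆p∪q ⁅ u ⁆ ⁅ v ⁆ (x∈⁅x⁆ v) , u≢v ∘ sym ∘ x∈⁅y⁆⇒x≡y u))
  ∈S : ∀ {x} → x ∈ S → x ≡ u ⊎ x ≡ v
  ∈S x∈S with x∈p∪q⁻ ⁅ u ⁆ ⁅ v ⁆ x∈S
  ... | inj₁ x∈u = inj₁ (x∈⁅y⁆⇒x≡y u x∈u)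
  ... | inj₂ x∈v = inj₂ (x∈⁅y⁆⇒x≡y v x∈v)
  independent : Independent G S
  independent x y x∈S y∈S x~y with ∈S x∈S | ∈S y∈S
  ... | inj₁ refl | inj₁ refl = ~-irrefl refl x~y
  ... | inj₁ refl | inj₂ refl = u≁v x~y
  ... | inj₂ refl | inj₁ refl = u≁v (~-sym x~y)
  ... | inj₂ refl | inj₂ refl = ~-irrefl refl x~y

-- Nonadjacent `u` and `v` would have distinct, nonadjacent positions in `elements U`, forcing
-- independence number at least 2.
α-induced≤1⇒clique : (G : Graph n) → let open Graph G in ∀ {U} → α (induced G U) ≤ 1 →
  ∀ {u v} → u ∈ U → v ∈ U → u ≢ v → u ~ v
α-induced≤1⇒clique {n = n} G {U} α≤1 {u} {v} u∈U v∈U u≢v =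
  decidable-stable (u ~? v) λ u≁v → ℕ.<⇒≱
    (nonadjacent⇒2≤α (induced G U) {index u∈U} {index v∈U}
      (λ i≡j → u≢v (trans (lookup-elements u∈U)
        (trans (cong (lookup (elements U)) i≡j) (sym (lookup-elements v∈U)))))
      (u≁v ∘ subst₂ _~_ (sym (lookup-elements u∈U)) (sym (lookup-elements v∈U))))
    α≤1
  where
  open Graph G
  ∈-elements : ∀ {x} → x ∈ U → x ∈ˡ elements U
  ∈-elements {x} x∈U = ∈-filter⁺ (_∈? U) (∈-allFin x) x∈U
  index : ∀ {x} → x ∈ U → _
  index x∈U = Any.index (∈-elements x∈U)
  lookup-elements : ∀ {x} (x∈U : x ∈ U) → x ≡ lookup (elements U) (index x∈U)
  lookup-elements x∈U = lookup-index (∈-elements x∈U)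

-- Bubble partitions into cliques

module CliquePartition {G : Graph n} (𝒱 : BubblePartition G) (α≤1 : α-partition G 𝒱 ≤ 1) where
  open Graph G
  open BubblePartition 𝒱

  classOf : Fin n → Fin size
  classOf v = proj₁ (partition v)

  v∈class : ∀ v → v ∈ class (classOf v)
  v∈class v = proj₁ (proj₂ (partition v))

  same-class⇒adjacent : ∀ {u v} → u ≢ v → classOf u ≡ classOf v → u ~ v
  same-class⇒adjacent {u} {v} u≢v cu≡cv =
    α-induced≤1⇒clique G α[class]≤1 (subst (λ i → u ∈ class i) cu≡cv (v∈class u)) (v∈class v) u≢v
    where
    α[class]≤1 : ∀ {i} → α (induced G (class i)) ≤ 1
    α[class]≤1 {i} = ℕ.≤-trans (All.lookup (xs≤max 0 _) (∈-map⁺ _ (∈-allFin i))) α≤1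

  -- Otherwise the three classes would be distinct and form a triangle in the contraction, which is
  -- a tree.
  triangle : ∀ {u v w} → u ~ v → u ~ w → v ~ w →
             classOf v ≢ classOf u → classOf w ≢ classOf u → classOf v ≡ classOf w
  triangle {u} {v} {w} u~v u~w v~w cv≢cu cw≢cu =
    decidable-stable (classOf v ≟ classOf w) λ cv≢cw →
      acyclic-triangle-free {G = contract G class} (proj₂ (proj₂ tree))
        (edge (cv≢cu ∘ sym) u~v) (edge cv≢cw v~w) (edge (cw≢cu ∘ sym) u~w)
    where
    edge : ∀ {x y} → classOf x ≢ classOf y → x ~ y →
           Graph._~_ (contract G class) (classOf x) (classOf y)
    edge {x} {y} cx≢cy x~y = cx≢cy , x , y , (v∈class x , v∈class y) , x~y

  path-meets-class : ∀ {u} (P : Fin 3 → Fin n) → (∀ i → u ~ P i) →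
    P (# 0) ~ P (# 1) → P (# 1) ~ P (# 2) → P (# 0) ≢ P (# 2) → ¬ (P (# 0) ~ P (# 2)) →
    ∃ λ i → classOf (P i) ≡ classOf u
  path-meets-class {u} P u~P a~b b~c a≢c a≁c =
    decidable-stable (any? λ i → classOf (P i) ≟ classOf u) λ none →
      let ∉cu = λ i cPi≡cu → none (i , cPi≡cu) in
      a≁c (same-class⇒adjacent a≢c (trans
        (triangle (u~P (# 0)) (u~P (# 1)) a~b (∉cu (# 0)) (∉cu (# 1)))
        (triangle (u~P (# 1)) (u~P (# 2)) b~c (∉cu (# 1)) (∉cu (# 2)))))

twins? : (G : Graph n) → Decidable (Twins G)
twins? G u v = (u ~? v) ×-dec ≡-dec _≟ᵇ_ (N u - v) (N v - u)
  where open Graph G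

-- A set of pairwise twins containing `v` and a second vertex would exhibit a twin of `v`.
twin-free⇒singleton-bubble : (G : Graph n) → (∀ u v → ¬ Twins G u v) → ∀ v → Bubble G ⁅ v ⁆
twin-free⇒singleton-bubble G twin-free v =
    (λ x y x∈v y∈v x≢y → contradiction (trans (x∈⁅y⁆⇒x≡y v x∈v) (sym (x∈⁅y⁆⇒x≡y v y∈v))) x≢y)
  , λ C twins v⊆C {x} x∈C → subst (_∈ ⁅ v ⁆)
      (decidable-stable (v ≟ x) λ v≢x → twin-free v x (twins v x (v⊆C (x∈⁅x⁆ v)) x∈C v≢x))
      (x∈⁅x⁆ v)

-- Separating examples

K₁ C₄ : FiniteGraph
K₁ = 0 , cycle 1
C₄ = 3 , cycle 4

K₁-interval : Interval K₁
K₁-interval = (λ _ → record { left≤right = ℚ.≤-refl {0ℚ} })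
            , λ { zero zero 0≢0 → contradiction refl 0≢0 }

K₁∈BW₁ : BW 1 K₁
-- The independence number of this concrete partition evaluates to 1.
K₁∈BW₁ = partition , ℕ.≤-refl
  where
  partition : BubblePartition (cycle 1)
  partition = record
    { size      = 1
    ; class     = λ _ → ⁅ # 0 ⁆
    ; nonempty  = λ _ → # 0 , x∈⁅x⁆ (# 0)
    ; partition = λ { zero → # 0 , x∈⁅x⁆ (# 0) , λ { {zero} _ → refl } }
    ; bubbles   = λ _ → ⁅ # 0 ⁆ ∷ []
        , twin-free⇒singleton-bubble (cycle 1)
            (from-yes (all? λ u → all? λ v → ¬? (twins? (cycle 1) u v))) (# 0) ∷ []
        , refl
    ; tree      = nonZero , (λ { zero zero → ε }) , acyclic-small (s≤s (s≤s z≤n)) _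
    }

C₄-not-chordal : ¬ Chordal C₄
C₄-not-chordal chordal = chordal 4 ℕ.≤-refl record
  { vertex = λ i → i ; injective = λ i≡j → i≡j ; edges = mk⇔ (λ e → e) (λ e → e) }

C₄∈BW₁ : BW 1 C₄
C₄∈BW₁ = 𝒱 , ℕ.≤-refl
  where
  class : Fin 2 → Subset 4
  -- Two opposite edges of the cycle: each is a clique, and the contraction is a single edge.
  class zero       = ⁅ # 0 ⁆ ∪ ⁅ # 1 ⁆
  class (suc zero) = ⁅ # 2 ⁆ ∪ ⁅ # 3 ⁆
  bubble : ∀ v → Bubble (cycle 4) ⁅ v ⁆
  bubble = twin-free⇒singleton-bubble (cycle 4)
    (from-yes (all? λ u → all? λ v → ¬? (twins? (cycle 4) u v)))
  bubbles : ∀ i → UnionOfBubbles (cycle 4) (class i)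
  bubbles zero       = ⁅ # 0 ⁆ ∷ ⁅ # 1 ⁆ ∷ [] , bubble (# 0) ∷ bubble (# 1) ∷ [] , refl
  bubbles (suc zero) = ⁅ # 2 ⁆ ∷ ⁅ # 3 ⁆ ∷ [] , bubble (# 2) ∷ bubble (# 3) ∷ [] , refl
  classOf : Fin 4 → Fin 2
  classOf zero          = # 0
  classOf (suc zero)    = # 0
  classOf (suc (suc _)) = # 1
  open Graph (contract (cycle 4) class)
  edge : # 0 ~ # 1
  edge = from-yes (# 0 ~? # 1)
  𝒱 : BubblePartition (cycle 4)
  𝒱 = record
    { size      = 2
    ; class     = class
    ; nonempty  = λ { zero       → # 0 , from-yes (# 0 ∈? class (# 0))
                    ; (suc zero) → # 2 , from-yes (# 2 ∈? class (# 1)) }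
    ; partition = λ v → classOf v
        , from-yes (all? λ v → v ∈? class (classOf v)) v
        , λ {i} → from-yes (all? λ v → all? λ i → (v ∈? class i) →-dec (classOf v ≟ i)) v i
    ; bubbles   = bubbles
    ; tree      = nonZero
        , (λ { zero       zero       → ε
             ; zero       (suc zero) → edge ◅ ε
             ; (suc zero) zero       → ~-sym edge ◅ ε
             ; (suc zero) (suc zero) → ε })
        , acyclic-small ℕ.≤-refl _
    }

-- For concrete endpoints in order, the implicit argument reduces to the unit type and is inferred.
[_,_]ᴵ : (a b : ℚ) {a≤b : True (a ≤? b)} → ClosedInterval
[ a , b ]ᴵ {a≤b} = record { left = a ; right = b ; left≤right = toWitness a≤b }

2P₃+universal-intervals : Fin 7 → ClosedInterval
2P₃+universal-intervals = Vec.lookup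
  -- The first interval meets all others and is the universal vertex. Each further row is a path
  -- whose middle interval contains two disjoint points; the gap between 1 and 2 separates the
  -- paths.
  ( [ 0ℚ , 3ℚ ]ᴵ
  ∷ [ 0ℚ , 0ℚ ]ᴵ ∷ [ 0ℚ , 1ℚ ]ᴵ ∷ [ 1ℚ , 1ℚ ]ᴵ
  ∷ [ 2ℚ , 2ℚ ]ᴵ ∷ [ 2ℚ , 3ℚ ]ᴵ ∷ [ 3ℚ , 3ℚ ]ᴵ
  ∷ [] )
  where
  2ℚ 3ℚ : ℚ
  2ℚ = 1ℚ +ℚ 1ℚ
  3ℚ = 2ℚ +ℚ 1ℚ

2P₃+universal : FiniteGraph
2P₃+universal = 6 , intersectionGraph 2P₃+universal-intervals

2P₃+universal-interval : Interval 2P₃+universal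
2P₃+universal-interval = intersectionGraph-interval 2P₃+universal-intervals

2P₃+universal∉BW₁ : ¬ BW 1 2P₃+universal
2P₃+universal∉BW₁ (𝒱 , α≤1) =
  let i , cPi≡cu = path-meets-class P (from-yes (all? λ i → # 0 ~? P i))
        (from-yes (# 1 ~? # 2)) (from-yes (# 2 ~? # 3)) (λ ()) (from-yes (¬? (# 1 ~? # 3)))
      j , cQj≡cu = path-meets-class Q (from-yes (all? λ i → # 0 ~? Q i))
        (from-yes (# 4 ~? # 5)) (from-yes (# 5 ~? # 6)) (λ ()) (from-yes (¬? (# 4 ~? # 6)))
      Pi≢Qj , Pi≁Qj = from-yes (all? λ i → all? λ j → ¬? (P i ≟ Q j) ×-dec ¬? (P i ~? Q j)) i j
  in  Pi≁Qj (same-class⇒adjacent Pi≢Qj (trans cPi≡cu (sym cQj≡cu)))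
  where
  open Graph (proj₂ 2P₃+universal)
  open CliquePartition 𝒱 α≤1
  P Q : Fin 3 → Fin 7
  -- `P` runs through the vertices 1, 2, 3 and `Q` through 4, 5, 6, each in path order.
  P i = suc (i ↑ˡ 3)
  Q i = 4 ↑ʳ i

theorem4 : Crossing (BW 1) Chordal × Crossing (BW 1) Interval
theorem4 =
    ( (K₁ , K₁∈BW₁ , interval⇒chordal K₁-interval)
    , (λ BW⊆Chordal → C₄-not-chordal (BW⊆Chordal C₄∈BW₁))
    , (λ Chordal⊆BW → 2P₃+universal∉BW₁ (Chordal⊆BW (interval⇒chordal 2P₃+universal-interval))))
  , ( (K₁ , K₁∈BW₁ , K₁-interval)
    , (λ BW⊆Interval → C₄-not-chordal (interval⇒chordal (BW⊆Interval C₄∈BW₁)))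
    , (λ Interval⊆BW → 2P₃+universal∉BW₁ (Interval⊆BW 2P₃+universal-interval)))
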